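{- Let $G=(V,E,w)$ be a finite connected graph with $|V|=n\ge2$ and weights $w:E\to\mathbb{R}_{>0}$. Then $$\operatorname{OPT}_D^-(G,w)=\operatorname{OPT}_{\mathrm{card}}(G,w)=\min_{T\in\mathcal T_{\mathrm{conn}}^{\mathrm{bin}}(G)}\ \sum_{xy\in E}w_{xy}h_T(x,y).$$ Moreover, for every $T\in\mathcal T_{\mathrm{conn}}^{\mathrm{bin}}(G)$ and all distinct $x,y\in V$, $$d_G(x,y)\le\operatorname{diam}_{d_G}\bigl(C_T(x,y)\bigr)\le|C_T(x,y)|-1=h_T(x,y)$$ (for $x=y$ all terms are $0$). Thus $h_T\ge d_G$ on all pairs in $V\times V$, not only on the edges.
   Context: $d_G$ is the shortest-path metric of the support graph $(V,E)$ with every edge of length $1$; the weights are not edge lengths. $\operatorname{diam}_{d_G}(S)=\max_{a,b\in S}d_G(a,b)$. A rooted binary hierarchy $T$ on $V$ is a rooted tree whose leaves are the vertices of $V$ and whose internal nodes have exactly two children; each node is identified with the set of leaves in its subtree (a cluster), and $C_T(x,y)$ is the cluster of the lowest common ancestor of $x,y$ (so $C_T(x,x)=\{x\}$). $\mathcal T_{\mathrm{bin}}(V)$ is the set of all rooted binary hierarchies on $V$, and $\mathcal T_{\mathrm{conn}}^{\mathrm{bin}}(G)$ the subset of those all of whose clusters induce connected subgraphs of $G$. The shifted cardinality labeling is $h_T(x,x)=0$ and $h_T(x,y)=|C_T(x,y)|-1$ for $x\neq y$. $\operatorname{OPT}_D^-(G,w)=\min_{T\in\mathcal T_{\mathrm{bin}}(V)}\sum_{xy\in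 E}w_{xy}(|C_T(x,y)|-1)$ is the shifted Dasgupta optimum. $\operatorname{OPT}_{\mathrm{card}}(G,w)$ is the minimum of $\sum_{xy\in E}w_{xy}h_H(x,y)$ over all $H\in\mathcal T_{\mathrm{bin}}(V)$ with $h_H(x,y)\ge d_G(x,y)$ for all $x,y\in V$. -}

module Defs where

open import Algebra.Bundles using (CommutativeRing)
import Algebra.Definitions.RawMonoid as RawMonoid
open import Data.Fin.Base as Fin using (Fin)
import Data.Fin.Properties as Fin
open import Data.Fin.Subset using (Subset; ⁅_⁆; _∪_; ∣_∣; _∈_)
open import Data.Fin.Subset.Properties using (_∈?_)
open import Data.List.Base
  using (List; [_]; _++_; map; filter; foldr; allFin; cartesianProduct)
open import Data.List.Extrema.Nat using (max)
open import Data.List.Relation.Binary.Permutation.Propositional using (_↭_)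
open import Data.Nat.Base using (ℕ; zero; suc; _≤_; z≤n; s≤s; _∸_)
open import Data.Product.Base using (∃; _×_; _,_; proj₁; uncurry)
open import Data.Unit.Base using (⊤)
open import Function.Base using (_∘_)
open import Level using (Level; _⊔_) renaming (suc to lsuc)
open import Relation.Binary.Core using (Rel)
open import Relation.Binary.Definitions
  using (Symmetric; Irreflexive) renaming (Decidable to Decidable₂)
open import Relation.Binary.PropositionalEquality using (_≡_; refl)
open import Relation.Binary.Structures using (IsTotalOrder)
import Relation.Binary.Construct.NonStrictToStrict as ToStrict
open import Relation.Nullary.Decidable.Core using (Dec; yes; no; map′; _×-dec_)
open import Relation.Nullary.Negation.Core using (¬_; contradiction)
open import Relation.Unary using (Decidable)

-- The library has no real numbers: weights are taken in an arbitrary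
-- totally ordered field, of which ℝ is (classically) an instance.
record OrderedField (c ℓ₁ ℓ₂ : Level) : Set (lsuc (c ⊔ ℓ₁ ⊔ ℓ₂)) where
  field
    commutativeRing : CommutativeRing c ℓ₁

  open CommutativeRing commutativeRing public

  infix 4 _≼_ _≺_

  field
    _≼_          : Rel Carrier ℓ₂
    isTotalOrder : IsTotalOrder _≈_ _≼_
    +-monoˡ-≼    : ∀ {x y} z → x ≼ y → x + z ≼ y + z
    *-nonNeg     : ∀ {x y} → 0# ≼ x → 0# ≼ y → 0# ≼ x * y
    1≉0          : ¬ 1# ≈ 0#
    inverse      : ∀ x → ¬ x ≈ 0# → ∃ λ y → x * y ≈ 1#

  _≺_ : Rel Carrier (ℓ₁ ⊔ ℓ₂)
  _≺_ = ToStrict._<_ _≈_ _≼_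

  fromℕ : ℕ → Carrier
  fromℕ k = RawMonoid._×_ +-rawMonoid k 1#

  ∑ : ∀ {n} → (Fin n → Carrier) → Carrier
  ∑ f = foldr _+_ 0# (map f (allFin _))

  -- "m is the minimum of f over all a satisfying P"; such an m is unique
  -- up to _≈_.
  IsMinimum : ∀ {a p} {A : Set a} → (A → Set p) → (A → Carrier) →
              Carrier → Set (a ⊔ p ⊔ ℓ₁ ⊔ ℓ₂)
  IsMinimum P f m = (∃ λ a → P a × f a ≈ m) × (∀ a → P a → m ≼ f a)

record Graph (V : Set) : Set₁ where
  infix 4 _~_ _~?_
  field
    _~_      : Rel V Level.zero
    ~-sym    : Symmetric _~_
    ~-irrefl : Irreflexive _≡_ _~_
    _~?_     : Decidable₂ _~_

induced : ∀ {n} → Graph (Fin n) → (S : Subset n) → Graph (∃ (_∈ S))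
induced G S = record
  { _~_      = λ u v → proj₁ u ~ proj₁ v
  ; ~-sym    = ~-sym
  ; ~-irrefl = λ { refl → ~-irrefl refl }
  ; _~?_     = λ u v → proj₁ u ~? proj₁ v
  }
  where open Graph G

data Walk {V : Set} (G : Graph V) : ℕ → V → V → Set where
  []  : ∀ {x} → Walk G 0 x x
  _∷_ : ∀ {k x y z} → Graph._~_ G x y → Walk G k y z → Walk G (suc k) x z

Connected : ∀ {V} → Graph V → Set
Connected G = ∀ x y → ∃ λ k → Walk G k x y

walk? : ∀ {n} (G : Graph (Fin n)) k x y → Dec (Walk G k x y)
walk? G zero    x y = map′ (λ { refl → [] }) (λ { [] → refl }) (x Fin.≟ y)
walk? G (suc k) x y =
  map′ (λ { (_ , e , p) → e ∷ p }) (λ { (e ∷ p) → _ , e , p })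
       (Fin.any? λ z → (x ~? z) ×-dec walk? G k z y)
  where open Graph G

least : ∀ {p} {P : ℕ → Set p} → Decidable P → ∀ k → P k →
        ∃ λ m → P m × (∀ j → P j → m ≤ j)
least P? k pk with P? 0
least P? k       pk | yes p0 = 0 , p0 , λ _ _ → z≤n
least P? zero    pk | no ¬p0 = contradiction pk ¬p0
least P? (suc k) pk | no ¬p0 with least (P? ∘ suc) k pk
... | m , pm , m≤ = suc m , pm , λ where
  zero    p0 → contradiction p0 ¬p0
  (suc j) pj → s≤s (m≤ j pj)

-- A shortest walk is a path, so minimising over walks gives d_G.
dist : ∀ {n} (G : Graph (Fin n)) → Connected G → Fin n → Fin n → ℕ
dist G conn x y = proj₁ (uncurry (least λ k → walk? G k x y) (conn x y))

diam : ∀ {n} → (Fin n → Fin n → ℕ) → Subset n → ℕ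
diam {n} d S = max 0 (map (uncurry d) (cartesianProduct elements elements))
  where elements = filter (_∈? S) (allFin n)

-- Left and right children are distinguished, but nothing below depends on
-- their order.
data Tree (V : Set) : Set where
  leaf : V → Tree V
  node : Tree V → Tree V → Tree V

leaves : ∀ {V} → Tree V → List V
leaves (leaf x)   = [ x ]
leaves (node l r) = leaves l ++ leaves r

record Hierarchy (n : ℕ) : Set where
  field
    tree     : Tree (Fin n)
    leaves-↭ : leaves tree ↭ allFin n

open Hierarchy public

-- S ⊑ T: S is the subtree rooted at some node of T.
data _⊑_ {V : Set} (S : Tree V) : Tree V → Set where
  root  : S ⊑ S
  left  : ∀ {l r} → S ⊑ l → S ⊑ node l r
  right : ∀ {l r} → S ⊑ r → S ⊑ node l r

cluster : ∀ {n} → Tree (Fin n) → Subset n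
cluster (leaf x)   = ⁅ x ⁆
cluster (node l r) = cluster l ∪ cluster r

-- The subtree rooted at the lowest common ancestor of x and y, provided
-- both are leaves of the tree: descend as long as one child contains both.
lca : ∀ {n} → Tree (Fin n) → Fin n → Fin n → Tree (Fin n)
lca (leaf z)   x y = leaf z
lca (node l r) x y
  with (x ∈? cluster l) ×-dec (y ∈? cluster l)
     | (x ∈? cluster r) ×-dec (y ∈? cluster r)
... | yes _ | _     = lca l x y
... | no  _ | yes _ = lca r x y
... | no  _ | no  _ = node l r

C : ∀ {n} → Hierarchy n → Fin n → Fin n → Subset n
C T x y = cluster (lca (tree T) x y)

h : ∀ {n} → Hierarchy n → Fin n → Fin n → ℕ
h T x y with x Fin.≟ y
... | yes _ = 0
... | no  _ = ∣ C T x y ∣ ∸ 1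

ConnectedClusters : ∀ {n} → Graph (Fin n) → Hierarchy n → Set
ConnectedClusters G T = ∀ {S} → S ⊑ tree T → Connected (induced G (cluster S))

module _ {c ℓ₁ ℓ₂} (F : OrderedField c ℓ₁ ℓ₂) where
  open OrderedField F using (Carrier; _≈_; _≺_; 0#; _*_; fromℕ; ∑; IsMinimum)

  -- By weight-sym (twice), the weight depends only on the unordered pair of
  -- endpoints and not on the adjacency proof.
  record Weighting {n} (G : Graph (Fin n)) : Set (c ⊔ ℓ₁ ⊔ ℓ₂) where
    open Graph G
    field
      weight     : ∀ {x y} → x ~ y → Carrier
      weight-sym : ∀ {x y} (e : x ~ y) (e′ : y ~ x) → weight e ≈ weight e′
      weight-pos : ∀ {x y} (e : x ~ y) → 0# ≺ weight e

  edgeTerm : ∀ {n} {G : Graph (Fin n)} → Weighting G →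
             (Fin n → Fin n → ℕ) → (x y : Fin n) →
             Dec (x Fin.< y) → Dec (Graph._~_ G x y) → Carrier
  edgeTerm w f x y (yes _) (yes e) = Weighting.weight w e * fromℕ (f x y)
  edgeTerm w f x y (yes _) (no  _) = 0#
  edgeTerm w f x y (no  _) _       = 0#

  -- ∑_{xy∈E} w_xy f(x,y); every unordered edge is counted once, as the pair
  -- with x < y.
  cost : ∀ {n} {G : Graph (Fin n)} → Weighting G →
         (Fin n → Fin n → ℕ) → Carrier
  cost {G = G} w f =
    ∑ λ x → ∑ λ y → edgeTerm w f x y (x Fin.<? y) (Graph._~?_ G x y)

  IsOPT-D : ∀ {n} {G : Graph (Fin n)} → Weighting G → Carrier → Set (ℓ₁ ⊔ ℓ₂)
  IsOPT-D {n} w =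
    IsMinimum {A = Hierarchy n} (λ _ → ⊤) (λ T → cost w (λ x y → ∣ C T x y ∣ ∸ 1))

  IsOPT-card : ∀ {n} {G : Graph (Fin n)} → Connected G → Weighting G →
               Carrier → Set (ℓ₁ ⊔ ℓ₂)
  IsOPT-card {G = G} conn w =
    IsMinimum (λ H → ∀ x y → dist G conn x y ≤ h H x y) (λ H → cost w (h H))

{-# OPTIONS --safe #-}
module Submission where

-- Everything rests on one refinement: for every hierarchy T there is a
-- hierarchy T′ with connected clusters such that, for every edge xy, the
-- cluster of the lowest common ancestor of x and y in T′ is contained in the
-- one in T.  T′ is built bottom-up.  To each subtree S of T is attached a
-- forest consisting of one connected tree for each connected component of the
-- subgraph induced by the cluster of S (components).  At a node, the forests
-- of the two children are united, and trees joined by an edge are merged, one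
-- pair at a time, until no two trees are adjacent; every tree formed on the
-- way is connected.  An edge inside a child keeps the cluster that it already
-- had.  An edge between the children only has to end up inside some component
-- of S, since in T its cluster is that of S (components-joined).  As G is
-- connected, the forest at the root of T is a single tree (single-tree).
--
-- Hence the minimum m of the shifted Dasgupta cost over all binary hierarchies,
-- which exists since finitely many trees underlie them, is also attained at a
-- hierarchy with connected clusters.  Such a hierarchy is feasible for the
-- cardinality problem: if all the clusters of a tree are connected, then any
-- two of its leaves are joined by a walk shorter than their number
-- (short-walk), so the diameter of each cluster is at most its size minus one.
-- Since h and the shifted cardinality agree on edges, m is a lower bound for
-- all three problems and is attained in each.

open import Defs
open import Data.Fin.Base using (Fin)
open import Data.Fin.Subset using (∣_∣)
open import Data.Nat.Base using (ℕ; _≤_; _∸_)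
open import Data.Product.Base using (∃; _×_)
open import Relation.Binary.PropositionalEquality using (_≡_; _≢_)

import Data.Fin.Base as Fin
import Data.Fin.Properties as Fin
open import Data.Fin.Subset
  using (Subset; inside; outside; _∈_; _∉_; _⊆_; _∪_)
open import Data.Fin.Subset.Properties
  using (_∈?_; x∈⁅x⁆; x∈⁅y⁆⇒x≡y; ∣⁅x⁆∣≡1; x∈p∪q⁺; x∈p∪q⁻; p⊆p∪q; q⊆p∪q;
         p⊆q⇒∣p∣≤∣q∣; ∣p∣≤∣p∪q∣; ∣q∣≤∣p∪q∣)
open import Data.List.Base as List
  using (List; []; _∷_; _++_; allFin; cartesianProduct; cartesianProductWith;
         concatMap; filter; foldr; length; map)
import Data.List.Extrema.Nat as Max
import Data.List.Membership.DecPropositional as DecMembership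
open import Data.List.Membership.Propositional using (find; lose)
import Data.List.Membership.Propositional as List
open import Data.List.Membership.Propositional.Properties
  using (∈-++⁺ˡ; ∈-++⁺ʳ; ∈-++⁻; ∈-allFin; ∈-map⁺; ∈-filter⁺; ∈-filter⁻;
         ∈-cartesianProduct⁺; ∈-cartesianProduct⁻; ∈-cartesianProductWith⁺;
         ∈-concatMap⁺; ∈-concatMap⁻)
open import Data.List.Membership.Propositional.Properties.WithK
  using (unique∧set⇒bag)
import Data.List.Properties as List
open import Data.List.Relation.Binary.BagAndSetEquality using (∼bag⇒↭)
open import Data.List.Relation.Binary.Disjoint.Propositional using (Disjoint)
open import Data.List.Relation.Binary.Permutation.Propositional
  using (_↭_; ↭-refl; ↭-sym; ↭-trans; ↭-reflexive; ↭⇒↭ₛ)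
open import Data.List.Relation.Binary.Permutation.Propositional.Properties
  using (∈-resp-↭; ++⁺; ++⁺ˡ; shifts; ↭-length)
import Data.List.Relation.Binary.Permutation.Setoid.Properties as ↭ₛ
open import Data.List.Relation.Unary.All as All using (All; []; _∷_)
import Data.List.Relation.Unary.All.Properties as All
open import Data.List.Relation.Unary.AllPairs using (AllPairs; []; _∷_)
open import Data.List.Relation.Unary.Any as Any using (Any; here; there)
open import Data.List.Relation.Unary.Unique.Propositional using (Unique)
open import Data.List.Relation.Unary.Unique.Propositional.Properties
  using (allFin⁺)
import Data.List.Relation.Unary.Unique.DecPropositional as DecUnique
open import Data.Nat.Base using (zero; suc; _<_; z≤n; s≤s)
import Data.Nat.Base as ℕ
import Data.Nat.Properties as ℕ
open import Data.Product.Base using (∃₂; _,_; proj₁; proj₂; uncurry)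
open import Data.Sum.Base using (_⊎_; inj₁; inj₂)
open import Data.Unit.Base using (tt)
open import Data.Vec.Base using ([]; _∷_; here; there)
open import Data.Vec.Properties.WithK using ([]=-irrelevant)
open import Function.Base using (_∘_; id)
open import Function.Bundles using (mk⇔)
open import Relation.Binary.PropositionalEquality
  using (refl; sym; trans; cong; subst; subst₂; setoid)
open import Relation.Binary.Structures using (IsTotalOrder)
open import Relation.Nullary.Decidable.Core using (Dec; yes; no; map′; _×-dec_)
open import Relation.Nullary.Negation.Core using (¬_; contradiction)
open import Relation.Unary using (Decidable)

private
  variable
    n : ℕ

-- Leaves, clusters and lowest common ancestors

Unique-++⁻ : ∀ {A : Set} (xs : List A) {ys} → Unique (xs ++ ys) →
             Unique xs × Unique ys × Disjoint xs ys
Unique-++⁻ []       uniq       = [] , uniq , λ ()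
Unique-++⁻ (x ∷ xs) (x∉ ∷ uniq)
  with uxs , uys , disj ← Unique-++⁻ xs uniq =
  All.++⁻ˡ xs x∉ ∷ uxs , uys , λ where
    (here refl , v∈ys) → All.lookup (All.++⁻ʳ xs x∉) v∈ys refl
    (there v∈xs , v∈ys) → disj (v∈xs , v∈ys)

∈cluster⇒∈leaves : ∀ {x} (t : Tree (Fin n)) → x ∈ cluster t → x List.∈ leaves t
∈cluster⇒∈leaves (leaf z)   x∈ = here (x∈⁅y⁆⇒x≡y z x∈)
∈cluster⇒∈leaves (node l r) x∈ with x∈p∪q⁻ (cluster l) (cluster r) x∈
... | inj₁ x∈l = ∈-++⁺ˡ (∈cluster⇒∈leaves l x∈l)
... | inj₂ x∈r = ∈-++⁺ʳ (leaves l) (∈cluster⇒∈leaves r x∈r)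

∈leaves⇒∈cluster : ∀ {x} (t : Tree (Fin n)) → x List.∈ leaves t → x ∈ cluster t
∈leaves⇒∈cluster (leaf z)   (here refl) = x∈⁅x⁆ z
∈leaves⇒∈cluster (node l r) x∈ with ∈-++⁻ (leaves l) x∈
... | inj₁ x∈l = x∈p∪q⁺ (inj₁ (∈leaves⇒∈cluster l x∈l))
... | inj₂ x∈r = x∈p∪q⁺ (inj₂ (∈leaves⇒∈cluster r x∈r))

-- A tree without repeated leaves has disjoint clusters at siblings.
disjoint-children : ∀ (l r : Tree (Fin n)) → Unique (leaves (node l r)) →
                    ∀ {x} → x ∈ cluster l → ¬ x ∈ cluster r
disjoint-children l r uniq x∈l x∈r =
  proj₂ (proj₂ (Unique-++⁻ (leaves l) uniq))
    (∈cluster⇒∈leaves l x∈l , ∈cluster⇒∈leaves r x∈r)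

cluster-nonempty : (t : Tree (Fin n)) → ∃ (_∈ cluster t)
cluster-nonempty (leaf z)   = z , x∈⁅x⁆ z
cluster-nonempty (node l r) with x , x∈l ← cluster-nonempty l =
  x , x∈p∪q⁺ (inj₁ x∈l)

⊑-trans : ∀ {V : Set} {S T U : Tree V} → S ⊑ T → T ⊑ U → S ⊑ U
⊑-trans S⊑T root        = S⊑T
⊑-trans S⊑T (left T⊑l)  = left (⊑-trans S⊑T T⊑l)
⊑-trans S⊑T (right T⊑r) = right (⊑-trans S⊑T T⊑r)

⊑⇒⊆ : {S T : Tree (Fin n)} → S ⊑ T → cluster S ⊆ cluster T
⊑⇒⊆ root        x∈ = x∈
⊑⇒⊆ (left S⊑l)  x∈ = x∈p∪q⁺ (inj₁ (⊑⇒⊆ S⊑l x∈))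
⊑⇒⊆ (right S⊑r) x∈ = x∈p∪q⁺ (inj₂ (⊑⇒⊆ S⊑r x∈))

unique-left : ∀ (l r : Tree (Fin n)) → Unique (leaves (node l r)) →
              Unique (leaves l)
unique-left l r uniq = proj₁ (Unique-++⁻ (leaves l) uniq)

unique-right : ∀ (l r : Tree (Fin n)) → Unique (leaves (node l r)) →
               Unique (leaves r)
unique-right l r uniq = proj₁ (proj₂ (Unique-++⁻ (leaves l) uniq))

unique-⊑ : {S T : Tree (Fin n)} → S ⊑ T → Unique (leaves T) → Unique (leaves S)
unique-⊑ root uniq = uniq
unique-⊑ {T = node l r} (left S⊑l)  uniq = unique-⊑ S⊑l (unique-left l r uniq)
unique-⊑ {T = node l r} (right S⊑r) uniq = unique-⊑ S⊑r (unique-right l r uniq)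

lca-⊑ : (t : Tree (Fin n)) (x y : Fin n) → lca t x y ⊑ t
lca-⊑ (leaf z)   x y = root
lca-⊑ (node l r) x y
  with (x ∈? cluster l) ×-dec (y ∈? cluster l)
     | (x ∈? cluster r) ×-dec (y ∈? cluster r)
... | yes _ | _     = left (lca-⊑ l x y)
... | no  _ | yes _ = right (lca-⊑ r x y)
... | no  _ | no  _ = root

lca-∋ : ∀ {x y} (t : Tree (Fin n)) → x ∈ cluster t → y ∈ cluster t →
        x ∈ cluster (lca t x y) × y ∈ cluster (lca t x y)
lca-∋ (leaf z) x∈ y∈ = x∈ , y∈
lca-∋ {x = x} {y} (node l r) x∈ y∈
  with (x ∈? cluster l) ×-dec (y ∈? cluster l)
     | (x ∈? cluster r) ×-dec (y ∈? cluster r)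
... | yes (x∈l , y∈l) | _               = lca-∋ l x∈l y∈l
... | no  _           | yes (x∈r , y∈r) = lca-∋ r x∈r y∈r
... | no  _           | no  _           = x∈ , y∈

-- The cluster of the lowest common ancestor is the least cluster containing
-- both vertices.
lca-least : ∀ {x y} {S} (t : Tree (Fin n)) → Unique (leaves t) → S ⊑ t →
            x ∈ cluster S → y ∈ cluster S → cluster (lca t x y) ⊆ cluster S
lca-least {x = x} {y} t _ root _ _ = ⊑⇒⊆ (lca-⊑ t x y)
lca-least {x = x} {y} (node l r) uniq (left S⊑l) x∈ y∈
  with (x ∈? cluster l) ×-dec (y ∈? cluster l)
     | (x ∈? cluster r) ×-dec (y ∈? cluster r)
... | yes _ | _ = lca-least l (unique-left l r uniq) S⊑l x∈ y∈
... | no ¬l | _ = contradiction (⊑⇒⊆ S⊑l x∈ , ⊑⇒⊆ S⊑l y∈) ¬l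
lca-least {x = x} {y} (node l r) uniq (right S⊑r) x∈ y∈
  with (x ∈? cluster l) ×-dec (y ∈? cluster l)
     | (x ∈? cluster r) ×-dec (y ∈? cluster r)
... | yes (x∈l , _) | _     =
  contradiction (⊑⇒⊆ S⊑r x∈) (disjoint-children l r uniq x∈l)
... | no _          | yes _ =
  lca-least r (unique-right l r uniq) S⊑r x∈ y∈
... | no _          | no ¬r =
  contradiction (⊑⇒⊆ S⊑r x∈ , ⊑⇒⊆ S⊑r y∈) ¬r

∣cluster-lca-xx∣ : ∀ {x} (t : Tree (Fin n)) → x ∈ cluster t →
                 ∣ cluster (lca t x x) ∣ ≡ 1
∣cluster-lca-xx∣ (leaf z) _ = ∣⁅x⁆∣≡1 z
∣cluster-lca-xx∣ {x = x} (node l r) x∈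
  with (x ∈? cluster l) ×-dec (x ∈? cluster l)
     | (x ∈? cluster r) ×-dec (x ∈? cluster r)
... | yes (x∈l , _) | _             = ∣cluster-lca-xx∣ l x∈l
... | no _          | yes (x∈r , _) = ∣cluster-lca-xx∣ r x∈r
... | no ¬l         | no ¬r with x∈p∪q⁻ (cluster l) (cluster r) x∈
...   | inj₁ x∈l = contradiction (x∈l , x∈l) ¬l
...   | inj₂ x∈r = contradiction (x∈r , x∈r) ¬r

disjoint⇒∣p∣+∣q∣≤∣p∪q∣ : (p q : Subset n) → (∀ {x} → x ∈ p → ¬ x ∈ q) →
                      ∣ p ∣ ℕ.+ ∣ q ∣ ≤ ∣ p ∪ q ∣
disjoint⇒∣p∣+∣q∣≤∣p∪q∣ [] [] _ = z≤n
disjoint⇒∣p∣+∣q∣≤∣p∪q∣ (outside ∷ p) (outside ∷ q) disj =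
  disjoint⇒∣p∣+∣q∣≤∣p∪q∣ p q λ x∈p x∈q → disj (there x∈p) (there x∈q)
disjoint⇒∣p∣+∣q∣≤∣p∪q∣ (inside ∷ p) (outside ∷ q) disj =
  s≤s (disjoint⇒∣p∣+∣q∣≤∣p∪q∣ p q λ x∈p x∈q → disj (there x∈p) (there x∈q))
disjoint⇒∣p∣+∣q∣≤∣p∪q∣ (outside ∷ p) (inside ∷ q) disj
  rewrite ℕ.+-suc ∣ p ∣ ∣ q ∣ =
  s≤s (disjoint⇒∣p∣+∣q∣≤∣p∪q∣ p q λ x∈p x∈q → disj (there x∈p) (there x∈q))
disjoint⇒∣p∣+∣q∣≤∣p∪q∣ (inside ∷ p) (inside ∷ q) disj =
  contradiction here (disj here)

module _ (T : Hierarchy n) where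

  leaves-unique : Unique (leaves (tree T))
  leaves-unique =
    ↭ₛ.Unique-resp-↭ (setoid _) (↭⇒↭ₛ (↭-sym (leaves-↭ T))) (allFin⁺ n)

  leaves-all : ∀ x → x ∈ cluster (tree T)
  leaves-all x =
    ∈leaves⇒∈cluster (tree T) (∈-resp-↭ (↭-sym (leaves-↭ T)) (∈-allFin x))

h≡∣C∣∸1 : ∀ (T : Hierarchy n) {x y} → x ≢ y → h T x y ≡ ∣ C T x y ∣ ∸ 1
h≡∣C∣∸1 T {x} {y} x≢y with x Fin.≟ y
... | yes x≡y = contradiction x≡y x≢y
... | no  _   = refl

hxx≡0 : ∀ (T : Hierarchy n) x → h T x x ≡ 0
hxx≡0 T x with x Fin.≟ x
... | yes _   = refl
... | no  x≢x = contradiction refl x≢x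

-- Walks

module _ {V : Set} {G : Graph V} where
  open Graph G

  infixr 5 _++ʷ_

  _++ʷ_ : ∀ {j k x y z} → Walk G j x y → Walk G k y z → Walk G (j ℕ.+ k) x z
  []      ++ʷ q = q
  (e ∷ p) ++ʷ q = e ∷ (p ++ʷ q)

  reverseʷ : ∀ {k x y} → Walk G k x y → Walk G k y x
  reverseʷ []              = []
  reverseʷ (_∷_ {k} {x} {y} {z} e p) =
    subst (λ j → Walk G j z x) (ℕ.+-comm k 1) (reverseʷ p ++ʷ (~-sym e ∷ []))

  -- A walk that leaves P has an edge that leaves P.
  crossing : ∀ {P : V → Set} → Decidable P → ∀ {k x y} → Walk G k x y →
             P x → ¬ P y → ∃₂ λ a b → P a × ¬ P b × a ~ b
  crossing P? []               px ¬py = contradiction px ¬py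
  crossing P? (_∷_ {y = z} e p) px ¬py with P? z
  ... | yes pz = crossing P? p pz ¬py
  ... | no ¬pz = _ , z , px , ¬pz , e

mapʷ : ∀ {V W : Set} {G : Graph V} {H : Graph W} (f : V → W) →
       (∀ {u v} → Graph._~_ G u v → Graph._~_ H (f u) (f v)) →
       ∀ {k u v} → Walk G k u v → Walk H k (f u) (f v)
mapʷ f f~ []      = []
mapʷ f f~ (e ∷ p) = f~ e ∷ mapʷ f f~ p

module _ {n} (G : Graph (Fin n)) where
  open Graph G

  -- All clusters of the tree induce connected subgraphs.
  ConnectedTree : Tree (Fin n) → Set
  ConnectedTree t = ∀ {S} → S ⊑ t → Connected (induced G (cluster S))

  connected-∪ : ∀ p q → Connected (induced G p) → Connected (induced G q) →
                ∀ {a b} → a ∈ p → b ∈ q → a ~ b →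
                Connected (induced G (p ∪ q))
  connected-∪ p q conn-p conn-q {a} {b} a∈p b∈q a~b (x , x∈) (y , y∈) =
    let j , v = from-a x∈
        k , w = from-a y∈
    in j ℕ.+ k , reverseʷ v ++ʷ w
    where
    a∈ : a ∈ p ∪ q
    a∈ = x∈p∪q⁺ (inj₁ a∈p)

    -- Walks in the larger graph may end at any membership proof, since these
    -- proofs are unique.
    embed : ∀ {s : Subset n} (s⊆ : s ⊆ p ∪ q) {k u v}
            {u∈ : proj₁ u ∈ p ∪ q} {v∈ : proj₁ v ∈ p ∪ q} →
            Walk (induced G s) k u v →
            Walk (induced G (p ∪ q)) k (proj₁ u , u∈) (proj₁ v , v∈)
    embed s⊆ {u∈ = u∈} {v∈} w =
      subst₂ (λ i j → Walk (induced G (p ∪ q)) _ (_ , i) (_ , j))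
        ([]=-irrelevant _ u∈) ([]=-irrelevant _ v∈)
        (mapʷ (λ (u , u∈s) → u , s⊆ u∈s) id w)

    from-a : ∀ {z} (z∈ : z ∈ p ∪ q) →
             ∃ λ k → Walk (induced G (p ∪ q)) k (a , a∈) (z , z∈)
    from-a {z} z∈ with x∈p∪q⁻ p q z∈
    ... | inj₁ z∈p = _ , embed (p⊆p∪q q) (proj₂ (conn-p (a , a∈p) (z , z∈p)))
    ... | inj₂ z∈q =
      let k , w = conn-q (b , b∈q) (z , z∈q)
      in suc k , _∷_ {y = b , x∈p∪q⁺ (inj₂ b∈q)} a~b (embed (q⊆p∪q p q) w)

  -- Vertices in different children of a node are joined by a walk in the one,
  -- a crossing edge, and a walk in the other.  The children are disjoint, so
  -- the bounds for the two walks add up to the size of the node's cluster.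
  short-walk : ∀ t → Unique (leaves t) → ConnectedTree t →
               ∀ {x y} → x ∈ cluster t → y ∈ cluster t →
               ∃ λ k → k < ∣ cluster t ∣ × Walk G k x y
  short-walk (leaf z) _ _ x∈ y∈
    with refl ← x∈⁅y⁆⇒x≡y z x∈ | refl ← x∈⁅y⁆⇒x≡y z y∈ =
    0 , ℕ.≤-reflexive (sym (∣⁅x⁆∣≡1 z)) , []
  short-walk (node l r) uniq conn {x} {y} x∈ y∈ =
    join (x∈p∪q⁻ (cluster l) (cluster r) x∈) (x∈p∪q⁻ (cluster l) (cluster r) y∈)
    where
    walk-l : ∀ {x y} → x ∈ cluster l → y ∈ cluster l →
             ∃ λ k → k < ∣ cluster l ∣ × Walk G k x y
    walk-l = short-walk l (unique-left l r uniq) (conn ∘ left)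

    walk-r : ∀ {x y} → x ∈ cluster r → y ∈ cluster r →
             ∃ λ k → k < ∣ cluster r ∣ × Walk G k x y
    walk-r = short-walk r (unique-right l r uniq) (conn ∘ right)

    across : ∀ {x y} → x ∈ cluster l → y ∈ cluster r →
             ∃ λ k → k < ∣ cluster l ∪ cluster r ∣ × Walk G k x y
    across x∈l y∈r
      with (a , _) , (b , b∈) , a∈l , b∉l , a~b ←
           crossing (λ u → proj₁ u ∈? cluster l)
             (proj₂ (conn root (_ , x∈p∪q⁺ (inj₁ x∈l)) (_ , x∈p∪q⁺ (inj₂ y∈r))))
             x∈l (λ y∈l → disjoint-children l r uniq y∈l y∈r)
      with x∈p∪q⁻ (cluster l) (cluster r) b∈
    ... | inj₁ b∈l = contradiction b∈l b∉l
    ... | inj₂ b∈r =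
      let j , j< , v = walk-l x∈l a∈l
          k , k< , w = walk-r b∈r y∈r
      in j ℕ.+ suc k
       , ℕ.≤-trans (ℕ.+-mono-≤ j< k<)
           (disjoint⇒∣p∣+∣q∣≤∣p∪q∣ (cluster l) (cluster r)
             (disjoint-children l r uniq))
       , v ++ʷ (a~b ∷ w)

    join : ∀ {x y} → x ∈ cluster l ⊎ x ∈ cluster r →
           y ∈ cluster l ⊎ y ∈ cluster r →
           ∃ λ k → k < ∣ cluster l ∪ cluster r ∣ × Walk G k x y
    join (inj₁ x∈l) (inj₁ y∈l) =
      let k , k< , w = walk-l x∈l y∈l
      in k , ℕ.≤-trans k< (∣p∣≤∣p∪q∣ (cluster l) (cluster r)) , w
    join (inj₁ x∈l) (inj₂ y∈r) = across x∈l y∈r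
    join (inj₂ x∈r) (inj₁ y∈l) =
      let k , k< , w = across y∈l x∈r
      in k , k< , reverseʷ w
    join (inj₂ x∈r) (inj₂ y∈r) =
      let k , k< , w = walk-r x∈r y∈r
      in k , ℕ.≤-trans k< (∣q∣≤∣p∪q∣ (cluster l) (cluster r)) , w

-- Refining a hierarchy to a connected one

  -- No edge has one end in the cluster of t and the other in that of u.
  NonAdjacent : Tree (Fin n) → Tree (Fin n) → Set
  NonAdjacent t u = ∀ {a b} → a ∈ cluster t → b ∈ cluster u → ¬ a ~ b

  -- Some edge has one end in the cluster of t and the other in that of u.
  Adjacent : Tree (Fin n) → Tree (Fin n) → Set
  Adjacent t u = ∃₂ λ a b → a ∈ cluster t × b ∈ cluster u × a ~ b

  adjacent? : ∀ t u → Dec (Adjacent t u)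
  adjacent? t u = Fin.any? λ a → Fin.any? λ b →
    (a ∈? cluster t) ×-dec ((b ∈? cluster u) ×-dec (a ~? b))

  -- Insert t into a forest of pairwise nonadjacent trees, merging it with
  -- all the trees that it is adjacent to.  A tree passed over before a merge
  -- stays nonadjacent to the merged tree, being nonadjacent to both its parts.
  insert : Tree (Fin n) → List (Tree (Fin n)) → List (Tree (Fin n))
  insert t [] = t ∷ []
  insert t (u ∷ us) with adjacent? t u
  ... | yes _ = insert (node t u) us
  ... | no  _ = u ∷ insert t us

  insert-leaves : ∀ t us →
                  concatMap leaves (insert t us) ↭ leaves t ++ concatMap leaves us
  insert-leaves t [] = ↭-refl
  insert-leaves t (u ∷ us) with adjacent? t u
  ... | yes _ = ↭-trans (insert-leaves (node t u) us)
                  (↭-reflexive (List.++-assoc (leaves t) (leaves u) _))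
  ... | no  _ = ↭-trans (++⁺ˡ (leaves u) (insert-leaves t us))
                  (shifts (leaves u) (leaves t))

  insert-connected : ∀ {t us} → ConnectedTree t → All ConnectedTree us →
                     All ConnectedTree (insert t us)
  insert-connected ct [] = ct ∷ []
  insert-connected {t} {u ∷ us} ct (cu ∷ cus) with adjacent? t u
  ... | no  _ = cu ∷ insert-connected {t} {us} ct cus
  ... | yes (a , b , a∈t , b∈u , a~b) = insert-connected {node t u} {us} joined cus
    where
    joined : ConnectedTree (node t u)
    joined root      =
      connected-∪ (cluster t) (cluster u) (ct root) (cu root) a∈t b∈u a~b
    joined (left S)  = ct S
    joined (right S) = cu S

  nonadjacent-node : ∀ {s t u} → NonAdjacent s t → NonAdjacent s u →
                     NonAdjacent s (node t u)
  nonadjacent-node {t = t} {u} s≁t s≁u a∈s b∈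
    with x∈p∪q⁻ (cluster t) (cluster u) b∈
  ... | inj₁ b∈t = s≁t a∈s b∈t
  ... | inj₂ b∈u = s≁u a∈s b∈u

  nonadjacent-insert : ∀ {s t us} → NonAdjacent s t → All (NonAdjacent s) us →
                       All (NonAdjacent s) (insert t us)
  nonadjacent-insert s≁t [] = s≁t ∷ []
  nonadjacent-insert {s} {t} {u ∷ us} s≁t (s≁u ∷ s≁us) with adjacent? t u
  ... | no  _ = s≁u ∷ nonadjacent-insert {s} {t} {us} s≁t s≁us
  ... | yes _ = nonadjacent-insert {s} {node t u} {us}
                  (nonadjacent-node {s} {t} {u} s≁t s≁u) s≁us

  insert-nonadjacent : ∀ {t us} → AllPairs NonAdjacent us →
                       AllPairs NonAdjacent (insert t us)
  insert-nonadjacent [] = [] ∷ []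
  insert-nonadjacent {t} {u ∷ us} (u≁us ∷ us≁) with adjacent? t u
  ... | yes _  = insert-nonadjacent {node t u} {us} us≁
  ... | no t≁u = nonadjacent-insert {u} {t} {us} u≁t u≁us
               ∷ insert-nonadjacent {t} {us} us≁
    where
    u≁t : NonAdjacent u t
    u≁t b∈u a∈t b~a = t≁u (_ , _ , a∈t , b∈u , ~-sym b~a)

  -- Insertion only makes trees grow, so a property that passes from a subtree
  -- to the trees containing it survives.
  module _ {p} {P : Tree (Fin n) → Set p}
           (P-up : ∀ {t u} → t ⊑ u → P t → P u) where

    insert-∋ : ∀ {t} us → P t → Any P (insert t us)
    insert-∋ [] pt = here pt
    insert-∋ {t} (u ∷ us) pt with adjacent? t u
    ... | yes _ = insert-∋ us (P-up (left root) pt)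
    ... | no  _ = there (insert-∋ us pt)

    insert-⊇ : ∀ {t us} → Any P us → Any P (insert t us)
    insert-⊇ {t} {u ∷ us} p∈ with adjacent? t u
    insert-⊇ {us = u ∷ us} (here pu)  | yes _ = insert-∋ us (P-up (right root) pu)
    insert-⊇               (there p∈) | yes _ = insert-⊇ p∈
    insert-⊇               (here pu)  | no  _ = here pu
    insert-⊇               (there p∈) | no  _ = there (insert-⊇ p∈)

    merge-⊇ˡ : ∀ {ts} us → Any P ts → Any P (foldr insert ts us)
    merge-⊇ˡ []       p∈ = p∈
    merge-⊇ˡ (u ∷ us) p∈ = insert-⊇ (merge-⊇ˡ us p∈)

    merge-⊇ʳ : ∀ ts {us} → Any P us → Any P (foldr insert ts us)
    merge-⊇ʳ ts {u ∷ us} (here pu)  = insert-∋ (foldr insert ts us) pu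
    merge-⊇ʳ ts {u ∷ us} (there p∈) = insert-⊇ (merge-⊇ʳ ts p∈)

  merge-leaves : ∀ ts us → concatMap leaves (foldr insert ts us) ↭
                           concatMap leaves ts ++ concatMap leaves us
  merge-leaves ts [] = ↭-reflexive (sym (List.++-identityʳ _))
  merge-leaves ts (u ∷ us) =
    ↭-trans (insert-leaves u (foldr insert ts us))
      (↭-trans (++⁺ˡ (leaves u) (merge-leaves ts us))
        (shifts (leaves u) (concatMap leaves ts)))

  merge-connected : ∀ {ts us} → All ConnectedTree ts → All ConnectedTree us →
                    All ConnectedTree (foldr insert ts us)
  merge-connected cts [] = cts
  merge-connected {ts} {u ∷ us} cts (cu ∷ cus) =
    insert-connected {u} {foldr insert ts us} cu (merge-connected cts cus)

  merge-nonadjacent : ∀ {ts} us → AllPairs NonAdjacent ts →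
                      AllPairs NonAdjacent (foldr insert ts us)
  merge-nonadjacent []       ts≁ = ts≁
  merge-nonadjacent (u ∷ us) ts≁ = insert-nonadjacent (merge-nonadjacent us ts≁)

  -- The connected components of the subgraph induced by the cluster of T,
  -- each represented by a tree on it all of whose clusters are connected.
  components : Tree (Fin n) → List (Tree (Fin n))
  components (leaf x)   = leaf x ∷ []
  components (node l r) = foldr insert (components l) (components r)

  components-leaves : ∀ T → concatMap leaves (components T) ↭ leaves T
  components-leaves (leaf x)   = ↭-refl
  components-leaves (node l r) =
    ↭-trans (merge-leaves (components l) (components r))
      (++⁺ (components-leaves l) (components-leaves r))

  components-connected : ∀ T → All ConnectedTree (components T)
  components-connected (leaf x) = single ∷ []
    where
    single : ConnectedTree (leaf x)
    single root (y , y∈) (z , z∈)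
      with refl ← x∈⁅y⁆⇒x≡y x y∈ | refl ← x∈⁅y⁆⇒x≡y x z∈
      with refl ← []=-irrelevant y∈ z∈ = 0 , []
  components-connected (node l r) =
    merge-connected (components-connected l) (components-connected r)

  components-nonadjacent : ∀ T → AllPairs NonAdjacent (components T)
  components-nonadjacent (leaf x)   = [] ∷ []
  components-nonadjacent (node l r) =
    merge-nonadjacent (components r) (components-nonadjacent l)

  ∈-component : ∀ {x} T → x ∈ cluster T →
                Any (λ t → x ∈ cluster t) (components T)
  ∈-component T x∈ =
    Any.map (λ {t} → ∈leaves⇒∈cluster t)
      (∈-concatMap⁻ leaves {xs = components T}
        (∈-resp-↭ (↭-sym (components-leaves T)) (∈cluster⇒∈leaves T x∈)))

  component-⊆ : ∀ {t} T → t List.∈ components T → cluster t ⊆ cluster T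
  component-⊆ {t} T t∈ x∈t =
    ∈leaves⇒∈cluster T
      (∈-resp-↭ (components-leaves T)
        (∈-concatMap⁺ leaves {xs = components T} (lose t∈ (∈cluster⇒∈leaves t x∈t))))

  -- Both ends of an edge lie in the same tree of a forest of pairwise
  -- nonadjacent trees, provided that they lie in the forest at all.
  edge-within : ∀ {x y ts} → AllPairs NonAdjacent ts → x ~ y →
                Any (λ t → x ∈ cluster t) ts → Any (λ t → y ∈ cluster t) ts →
                Any (λ t → x ∈ cluster t × y ∈ cluster t) ts
  edge-within _ _ (here x∈) (here y∈) = here (x∈ , y∈)
  edge-within (t≁ ∷ _) x~y (here x∈) (there y∈)
    with u∈ , y∈u ← proj₂ (find y∈) = contradiction x~y (All.lookup t≁ u∈ x∈ y∈u)
  edge-within (t≁ ∷ _) x~y (there x∈) (here y∈)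
    with u∈ , x∈u ← proj₂ (find x∈) =
    contradiction (~-sym x~y) (All.lookup t≁ u∈ y∈ x∈u)
  edge-within (_ ∷ ts≁) x~y (there x∈) (there y∈) =
    there (edge-within ts≁ x~y x∈ y∈)

  -- Some cluster of t contains both x and y and is contained in p.
  JoinedWithin : Subset n → Fin n → Fin n → Tree (Fin n) → Set
  JoinedWithin p x y t =
    ∃ λ S → S ⊑ t × x ∈ cluster S × y ∈ cluster S × cluster S ⊆ p

  JoinedWithin-up : ∀ {p x y t u} → t ⊑ u →
                    JoinedWithin p x y t → JoinedWithin p x y u
  JoinedWithin-up t⊑u (S , S⊑t , rest) = S , ⊑-trans S⊑t t⊑u , rest

  -- Every edge inside a cluster of T lies inside a cluster of a component tree
  -- that is contained in it.  For the root cluster of T, a whole component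
  -- serves; for a cluster below a child, the cluster found in the components
  -- of the child survives the merging.
  components-joined : ∀ {x y S} T → S ⊑ T → x ~ y →
                      x ∈ cluster S → y ∈ cluster S →
                      Any (JoinedWithin (cluster S) x y) (components T)
  components-joined T root x~y x∈ y∈
    with t , t∈ , x∈t , y∈t ← find
      (edge-within (components-nonadjacent T) x~y
        (∈-component T x∈) (∈-component T y∈)) =
    lose t∈ (t , root , x∈t , y∈t , component-⊆ T t∈)
  components-joined (node l r) (left S⊑l) x~y x∈ y∈ =
    merge-⊇ˡ JoinedWithin-up (components r)
      (components-joined l S⊑l x~y x∈ y∈)
  components-joined (node l r) (right S⊑r) x~y x∈ y∈ =
    merge-⊇ʳ JoinedWithin-up (components l)
      (components-joined r S⊑r x~y x∈ y∈)

  -- In a connected graph, a forest of pairwise nonadjacent trees that contains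
  -- all the vertices is a single tree; it is nonempty as there is a vertex.
  single-tree : Connected G → ∀ ts → AllPairs NonAdjacent ts →
                concatMap leaves ts ↭ allFin n → Fin n → ∃ λ t → ts ≡ t ∷ []
  single-tree conn [] _ all x =
    contradiction (∈-resp-↭ (↭-sym all) (∈-allFin x)) λ ()
  single-tree conn (t ∷ []) _ _ _ = t , refl
  single-tree conn (t ∷ u ∷ us) (t≁ ∷ _) all _ =
    let x , x∈t = cluster-nonempty t
        y , y∈u = cluster-nonempty u
        y∉t : y ∉ cluster t
        y∉t y∈t = disjoint-t (∈cluster⇒∈leaves t y∈t , ∈-++⁺ˡ (∈cluster⇒∈leaves u y∈u))
        a , b , a∈t , b∉t , a~b =
          crossing (_∈? cluster t) (proj₂ (conn x y)) x∈t y∉t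
    in contradiction a~b (nonadjacent-outside a∈t b∉t)
    where
    disjoint-t : Disjoint (leaves t) (leaves u ++ concatMap leaves us)
    disjoint-t = proj₂ (proj₂ (Unique-++⁻ (leaves t)
      (↭ₛ.Unique-resp-↭ (setoid _) (↭⇒↭ₛ (↭-sym all)) (allFin⁺ n))))

    nonadjacent-outside : ∀ {a b} → a ∈ cluster t → b ∉ cluster t → ¬ a ~ b
    nonadjacent-outside {b = b} a∈t b∉t a~b
      with find (∈-concatMap⁻ leaves {xs = t ∷ u ∷ us}
                  (∈-resp-↭ (↭-sym all) (∈-allFin b)))
    ... | _ , here refl , b∈ = b∉t (∈leaves⇒∈cluster t b∈)
    ... | v , there v∈  , b∈ = All.lookup t≁ v∈ a∈t (∈leaves⇒∈cluster v b∈) a~b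

  -- The bound on sizes is asserted for edges only: other pairs may have a
  -- larger cluster in T′ than in T.
  connected-refinement : Connected G → Fin n → (T : Hierarchy n) →
    ∃ λ T′ → ConnectedClusters G T′ ×
             (∀ {x y} → x ~ y → ∣ C T′ x y ∣ ≤ ∣ C T x y ∣)
  connected-refinement conn x₀ T
    with t , eq ← single-tree conn (components (tree T))
                    (components-nonadjacent (tree T))
                    (↭-trans (components-leaves (tree T)) (leaves-↭ T)) x₀ =
    T′ , (λ {S} → conn′) , smaller
    where
    T′ : Hierarchy n
    T′ = record
      { tree     = t
      ; leaves-↭ = ↭-trans (↭-reflexive (sym
          (trans (cong (concatMap leaves) eq) (List.++-identityʳ (leaves t)))))
          (↭-trans (components-leaves (tree T)) (leaves-↭ T))
      }

    conn′ : ConnectedTree t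
    conn′ = All.head (subst (All ConnectedTree) eq (components-connected (tree T)))

    smaller : ∀ {x y} → x ~ y → ∣ C T′ x y ∣ ≤ ∣ C T x y ∣
    smaller {x} {y} x~y
      with x∈ , y∈ ← lca-∋ (tree T) (leaves-all T x) (leaves-all T y)
      with here (S , S⊑t , x∈S , y∈S , S⊆) ←
        subst (Any (JoinedWithin (C T x y) x y)) eq
          (components-joined (tree T) (lca-⊑ (tree T) x y) x~y x∈ y∈) =
      p⊆q⇒∣p∣≤∣q∣ (S⊆ ∘ lca-least t (leaves-unique T′) S⊑t x∈S y∈S)

-- Enumerating hierarchies

-- All the trees of height less than k, and so, in particular, all those with
-- at most k leaves.
trees : ℕ → List (Tree (Fin n))
trees         zero    = []
trees {n = n} (suc k) =
  map leaf (allFin n) ++ cartesianProductWith node (trees k) (trees k)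

leaves-nonempty : ∀ {V : Set} (t : Tree V) → 0 < length (leaves t)
leaves-nonempty (leaf x)   = s≤s z≤n
leaves-nonempty (node l r) rewrite List.length-++ (leaves l) {leaves r} =
  ℕ.≤-trans (leaves-nonempty l) (ℕ.m≤m+n _ _)

∈-trees : ∀ k (t : Tree (Fin n)) → length (leaves t) ≤ k → t List.∈ trees k
∈-trees zero    t ≤0 =
  contradiction (ℕ.≤-trans (leaves-nonempty t) ≤0) λ ()
∈-trees (suc k) (leaf x) _ = ∈-++⁺ˡ (∈-map⁺ leaf (∈-allFin x))
∈-trees {n = n} (suc k) (node l r) ≤k
  rewrite List.length-++ (leaves l) {leaves r} =
  ∈-++⁺ʳ (map leaf (allFin n)) (∈-cartesianProductWith⁺ node
    (∈-trees k l (ℕ.≤-pred (ℕ.≤-trans (ℕ.m<m+n _ (leaves-nonempty r)) ≤k)))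
    (∈-trees k r (ℕ.≤-pred (ℕ.≤-trans (ℕ.m<n+m _ (leaves-nonempty l)) ≤k))))

tree∈trees : (T : Hierarchy n) → tree T List.∈ trees n
tree∈trees {n} T = ∈-trees n (tree T) (ℕ.≤-reflexive
  (trans (↭-length (leaves-↭ T)) (List.length-tabulate {n = n} id)))

-- A list is a permutation of allFin n just when it repeats nothing and
-- contains everything.
isHierarchy? : (t : Tree (Fin n)) → Dec (leaves t ↭ allFin n)
isHierarchy? {n} t =
  map′ to from (unique? (leaves t) ×-dec Fin.all? (λ x → x ∈ₗ? leaves t))
  where
  open DecUnique (Fin._≟_ {n}) using (unique?)
  open DecMembership (Fin._≟_ {n}) using () renaming (_∈?_ to _∈ₗ?_)

  to : Unique (leaves t) × (∀ x → x List.∈ leaves t) → leaves t ↭ allFin n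
  to (uniq , all) = ∼bag⇒↭ (unique∧set⇒bag uniq (allFin⁺ n)
    (mk⇔ (λ _ → ∈-allFin _) (λ _ → all _)))

  from : leaves t ↭ allFin n → Unique (leaves t) × (∀ x → x List.∈ leaves t)
  from t↭ = let T = record { tree = t ; leaves-↭ = t↭ } in
    leaves-unique T , λ x → ∈-resp-↭ (↭-sym t↭) (∈-allFin x)

-- The tree on x ∷ ys in which every left child is a leaf.
caterpillar : Fin n → List (Fin n) → Tree (Fin n)
caterpillar x []       = leaf x
caterpillar x (y ∷ ys) = node (leaf x) (caterpillar y ys)

caterpillar-leaves : ∀ (x : Fin n) ys → leaves (caterpillar x ys) ≡ x ∷ ys
caterpillar-leaves x []       = refl
caterpillar-leaves x (y ∷ ys) = cong (x ∷_) (caterpillar-leaves y ys)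

someHierarchy : ∀ n → Hierarchy (suc n)
someHierarchy n = record
  { tree     = caterpillar Fin.zero (List.tabulate Fin.suc)
  ; leaves-↭ = ↭-reflexive (caterpillar-leaves Fin.zero (List.tabulate Fin.suc))
  }

-- Distances in a connected hierarchy

module _ {n} (G : Graph (Fin n)) (conn : Connected G) where

  dist-≤ : ∀ {k} x y → Walk G k x y → dist G conn x y ≤ k
  dist-≤ {k} x y w =
    proj₂ (proj₂ (uncurry (least λ k → walk? G k x y) (conn x y))) k w

  private
    elements : Subset n → List (Fin n)
    elements S = filter (_∈? S) (allFin n)

  dist≤diam : ∀ S {x y} → x ∈ S → y ∈ S → dist G conn x y ≤ diam (dist G conn) S
  dist≤diam S x∈ y∈ =
    All.lookup (Max.xs≤max 0 _)
      (∈-map⁺ (uncurry (dist G conn)) (∈-cartesianProduct⁺ (element x∈) (element y∈)))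
    where
    element : ∀ {z} → z ∈ S → z List.∈ elements S
    element z∈ = ∈-filter⁺ (_∈? S) (∈-allFin _) z∈

  diam≤ : ∀ S {b} → (∀ {x y} → x ∈ S → y ∈ S → dist G conn x y ≤ b) →
          diam (dist G conn) S ≤ b
  diam≤ S {b} bound = Max.max≤v⁺ z≤n (All.map⁺ (All.tabulate bound-pair))
    where
    element : ∀ {z} → z List.∈ elements S → z ∈ S
    element z∈ = proj₂ (∈-filter⁻ (_∈? S) {xs = allFin n} z∈)

    bound-pair : ∀ {xy} → xy List.∈ cartesianProduct (elements S) (elements S) →
                 uncurry (dist G conn) xy ≤ b
    bound-pair xy∈ =
      let x∈ , y∈ = ∈-cartesianProduct⁻ (elements S) (elements S) xy∈
      in bound (element x∈) (element y∈)

  module _ (T : Hierarchy n) (conn-T : ConnectedClusters G T) (x y : Fin n) where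

    C-∋ : x ∈ C T x y × y ∈ C T x y
    C-∋ = lca-∋ (tree T) (leaves-all T x) (leaves-all T y)

    dist≤diam-C : dist G conn x y ≤ diam (dist G conn) (C T x y)
    dist≤diam-C = uncurry (dist≤diam (C T x y)) C-∋

    diam-C≤ : diam (dist G conn) (C T x y) ≤ ∣ C T x y ∣ ∸ 1
    diam-C≤ = diam≤ (C T x y) λ u∈ v∈ →
      let k , k< , w = short-walk G (lca (tree T) x y)
                         (unique-⊑ lca⊑ (leaves-unique T))
                         (λ {S} S⊑ → conn-T (⊑-trans S⊑ lca⊑)) u∈ v∈
      in ℕ.≤-trans (dist-≤ _ _ w) (ℕ.∸-monoˡ-≤ 1 k<)
      where
      lca⊑ : lca (tree T) x y ⊑ tree T
      lca⊑ = lca-⊑ (tree T) x y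

  dist≤h : ∀ T → ConnectedClusters G T → ∀ x y → dist G conn x y ≤ h T x y
  dist≤h T conn-T x y = by-cases (x Fin.≟ y)
    where
    by-cases : Dec (x ≡ y) → dist G conn x y ≤ h T x y
    by-cases (yes refl) = ℕ.≤-trans (dist-≤ x x []) z≤n
    by-cases (no x≢y)   = begin
      dist G conn x y                ≤⟨ dist≤diam-C T (λ {S} → conn-T {S}) x y ⟩
      diam (dist G conn) (C T x y)   ≤⟨ diam-C≤ T (λ {S} → conn-T {S}) x y ⟩
      ∣ C T x y ∣ ∸ 1                ≡⟨ h≡∣C∣∸1 T x≢y ⟨
      h T x y                        ∎
      where open ℕ.≤-Reasoning

-- Costs and their minima in an ordered field

module _ {c ℓ₁ ℓ₂} (F : OrderedField c ℓ₁ ℓ₂) where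
  open OrderedField F
    hiding (refl; sym; trans; zero)
  open IsTotalOrder isTotalOrder
    using (antisym; total; module Eq)
    renaming (refl to ≼-refl; trans to ≼-trans;
              ≲-respʳ-≈ to ≼-respʳ-≈; ≲-respˡ-≈ to ≼-respˡ-≈)
  open import Algebra.Properties.Ring ring
    using (-‿distribˡ-*; x[y-z]≈xy-xz; -‿involutive)

  +-mono-≼ : ∀ {a b x y} → a ≼ b → x ≼ y → a + x ≼ b + y
  +-mono-≼ {a} {b} {x} {y} a≼b x≼y =
    ≼-trans (+-monoˡ-≼ x a≼b)
      (≼-respˡ-≈ (+-comm x b) (≼-respʳ-≈ (+-comm y b) (+-monoˡ-≼ b x≼y)))

  ≼⇒0≼- : ∀ {x y} → x ≼ y → 0# ≼ y - x
  ≼⇒0≼- {x} x≼y = ≼-respˡ-≈ (-‿inverseʳ x) (+-monoˡ-≼ (- x) x≼y)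

  0≼-⇒≼ : ∀ {x y} → 0# ≼ y - x → x ≼ y
  0≼-⇒≼ {x} {y} 0≼ =
    ≼-respˡ-≈ (+-identityˡ x) (≼-respʳ-≈ cancel (+-monoˡ-≼ x 0≼))
    where
    cancel : y - x + x ≈ y
    cancel = Eq.trans (+-assoc y (- x) x)
      (Eq.trans (+-congˡ (-‿inverseˡ x)) (+-identityʳ y))

  *-monoˡ-≼ : ∀ {w x y} → 0# ≼ w → x ≼ y → w * x ≼ w * y
  *-monoˡ-≼ {w} {x} {y} 0≼w x≼y =
    0≼-⇒≼ (≼-respʳ-≈ (x[y-z]≈xy-xz w y x) (*-nonNeg 0≼w (≼⇒0≼- x≼y)))

  -- If 1 ≼ 0 then 0 ≼ -1, so 0 ≼ (-1)(-1) = 1.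
  0≼1 : 0# ≼ 1#
  0≼1 with total 0# 1#
  ... | inj₁ 0≼1 = 0≼1
  ... | inj₂ 1≼0 = ≼-respʳ-≈ square (*-nonNeg 0≼-1 0≼-1)
    where
    0≼-1 : 0# ≼ - 1#
    0≼-1 = ≼-respʳ-≈ (+-identityˡ (- 1#)) (≼⇒0≼- 1≼0)

    square : - 1# * - 1# ≈ 1#
    square = Eq.trans (Eq.sym (-‿distribˡ-* 1# (- 1#)))
      (Eq.trans (-‿cong (*-identityˡ (- 1#))) (-‿involutive 1#))

  fromℕ-mono : ∀ {j k} → j ≤ k → fromℕ j ≼ fromℕ k
  fromℕ-mono {k = zero}  z≤n       = ≼-refl
  fromℕ-mono {k = suc k} z≤n       =
    ≼-respˡ-≈ (+-identityˡ 0#) (+-mono-≼ 0≼1 (fromℕ-mono {k = k} z≤n))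
  fromℕ-mono             (s≤s j≤k) = +-mono-≼ ≼-refl (fromℕ-mono j≤k)

  ∑-mono : ∀ {f g : Fin n → Carrier} → (∀ x → f x ≼ g x) → ∑ f ≼ ∑ g
  ∑-mono {n} {f} {g} f≼g = go (allFin n)
    where
    go : ∀ xs → foldr _+_ 0# (map f xs) ≼ foldr _+_ 0# (map g xs)
    go []       = ≼-refl
    go (x ∷ xs) = +-mono-≼ (f≼g x) (go xs)

  module _ {n} {G : Graph (Fin n)} (w : Weighting F G) where
    open Graph G

    cost-mono : ∀ {f g} → (∀ {x y} → x ~ y → f x y ≤ g x y) →
                cost F w f ≼ cost F w g
    cost-mono {f} {g} f≤g = ∑-mono λ x → ∑-mono λ y → term x y (x Fin.<? y) (x ~? y)
      where
      term : ∀ x y x<y? x~y? →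
             edgeTerm F w f x y x<y? x~y? ≼ edgeTerm F w g x y x<y? x~y?
      term x y (yes _) (yes e) =
        *-monoˡ-≼ (proj₁ (Weighting.weight-pos w e)) (fromℕ-mono (f≤g e))
      term x y (yes _) (no  _) = ≼-refl
      term x y (no  _) _       = ≼-refl

    cost-cong : ∀ {f g} → (∀ {x y} → x ~ y → f x y ≡ g x y) →
                cost F w f ≈ cost F w g
    cost-cong f≡g = antisym (cost-mono (ℕ.≤-reflexive ∘ f≡g))
                            (cost-mono (ℕ.≤-reflexive ∘ sym ∘ f≡g))

    -- The ends of an edge are distinct, and there h is the shifted cardinality.
    cost-h : ∀ T → cost F w (h T) ≈ cost F w (λ x y → ∣ C T x y ∣ ∸ 1)
    cost-h T = cost-cong λ x~y → h≡∣C∣∸1 T λ { refl → ~-irrefl refl x~y }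

  -- Among the members of a list that satisfy P, if any, one minimises f.
  list-minimum : ∀ {a p} {A : Set a} {P : A → Set p} → Decidable P →
                 (f : A → Carrier) (xs : List A) →
                 All (λ x → ¬ P x) xs ⊎
                 (∃ λ m → P m × All (λ x → P x → f m ≼ f x) xs)
  list-minimum P? f [] = inj₁ []
  list-minimum P? f (x ∷ xs) with P? x | list-minimum P? f xs
  ... | no ¬px | inj₁ none             = inj₁ (¬px ∷ none)
  ... | no ¬px | inj₂ (m , pm , m≼)    =
    inj₂ (m , pm , (λ px → contradiction px ¬px) ∷ m≼)
  ... | yes px | inj₁ none             =
    inj₂ (x , px , (λ _ → ≼-refl) ∷ All.map (λ ¬py py → contradiction py ¬py) none)
  ... | yes px | inj₂ (m , pm , m≼) with total (f x) (f m)
  ...   | inj₁ x≼m = inj₂ (x , px , (λ _ → ≼-refl) ∷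
                           All.map (λ m≼y py → ≼-trans x≼m (m≼y py)) m≼)
  ...   | inj₂ m≼x = inj₂ (m , pm , (λ _ → m≼x) ∷ m≼)

  -- A function of the underlying tree attains its minimum over hierarchies,
  -- since finitely many trees underlie them.
  hierarchy-minimum : (f : Tree (Fin n) → Carrier) → Hierarchy n →
                      ∃ λ (M : Hierarchy n) → ∀ T → f (tree M) ≼ f (tree T)
  hierarchy-minimum {n} f T₀ with list-minimum isHierarchy? f (trees n)
  ... | inj₁ none =
    contradiction (leaves-↭ T₀) (All.lookup none (tree∈trees T₀))
  ... | inj₂ (m , m-↭ , m≼) =
    record { tree = m ; leaves-↭ = m-↭ } ,
    λ T → All.lookup m≼ (tree∈trees T) (leaves-↭ T)

corollary4 : ∀ {c ℓ₁ ℓ₂} (F : OrderedField c ℓ₁ ℓ₂) (n : ℕ) → 2 ≤ n →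
    (G : Graph (Fin n)) (conn : Connected G) (w : Weighting F G) →
    (∃ λ m → IsOPT-D F w m × IsOPT-card F conn w m
    × OrderedField.IsMinimum F (ConnectedClusters G) (λ T → cost F w (h T)) m)
    × (∀ (T : Hierarchy n) → ConnectedClusters G T →
    (∀ x y → x ≢ y →
    dist G conn x y ≤ diam (dist G conn) (C T x y)
    × diam (dist G conn) (C T x y) ≤ ∣ C T x y ∣ ∸ 1
    × ∣ C T x y ∣ ∸ 1 ≡ h T x y)
    × (∀ x → dist G conn x x ≡ 0
    × diam (dist G conn) (C T x x) ≡ 0
    × ∣ C T x x ∣ ∸ 1 ≡ 0
    × h T x x ≡ 0)
    × (∀ x y → dist G conn x y ≤ h T x y))
corollary4 F n@(suc n-1) 2≤n G conn w =
  ( cost-D M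
  , ((M , tt , Eq.refl) , λ T _ → M-least T)
  , ((M′ , dist≤h G conn M′ (λ {S} → conn-M′ {S}) , M′-attains) ,
     λ T _ → least-h T)
  , ((M′ , (λ {S} → conn-M′ {S}) , M′-attains) , λ T _ → least-h T)
  )
  , λ T conn-T →
    (λ x y x≢y → dist≤diam-C G conn T (λ {S} → conn-T {S}) x y
               , diam-C≤ G conn T (λ {S} → conn-T {S}) x y
               , sym (h≡∣C∣∸1 T x≢y))
  , (λ x → let ∣C∣∸1≡0 = cong (_∸ 1) (∣cluster-lca-xx∣ (tree T) (leaves-all T x)) in
      ℕ.n≤0⇒n≡0 (dist-≤ G conn x x [])
    , ℕ.n≤0⇒n≡0 (subst (diam (dist G conn) (C T x x) ≤_) ∣C∣∸1≡0
        (diam-C≤ G conn T (λ {S} → conn-T {S}) x x))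
    , ∣C∣∸1≡0
    , hxx≡0 T x)
  , dist≤h G conn T (λ {S} → conn-T {S})
  where
  open OrderedField F using (Carrier; _≈_; _≼_; isTotalOrder)
  open IsTotalOrder isTotalOrder
    using (antisym; module Eq) renaming (≲-respʳ-≈ to ≼-respʳ-≈)

  cost-D : Hierarchy n → Carrier
  cost-D T = cost F w (λ x y → ∣ C T x y ∣ ∸ 1)

  minimum : ∃ λ M → ∀ T → cost-D M ≼ cost-D T
  minimum = hierarchy-minimum F
    (λ t → cost F w (λ x y → ∣ cluster (lca t x y) ∣ ∸ 1)) (someHierarchy n-1)

  -- A hierarchy of least shifted cost; its refinement M′ attains the minimum in
  -- all three problems.
  M : Hierarchy n
  M = proj₁ minimum

  M-least : ∀ T → cost-D M ≼ cost-D T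
  M-least = proj₂ minimum

  least-h : ∀ T → cost-D M ≼ cost F w (h T)
  least-h T = ≼-respʳ-≈ (Eq.sym (cost-h F w T)) (M-least T)

  refinement : ∃ λ T′ → ConnectedClusters G T′ ×
                 (∀ {x y} → Graph._~_ G x y → ∣ C T′ x y ∣ ≤ ∣ C M x y ∣)
  refinement = connected-refinement G conn Fin.zero M

  M′ : Hierarchy n
  M′ = proj₁ refinement

  conn-M′ : ConnectedClusters G M′
  conn-M′ = proj₁ (proj₂ refinement)

  M′-attains : cost F w (h M′) ≈ cost-D M
  M′-attains = Eq.trans (cost-h F w M′) (antisym
    (cost-mono F w λ x~y → ℕ.∸-monoˡ-≤ 1 (proj₂ (proj₂ refinement) x~y))
    (M-least M′))
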